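{- For every integer $k\ge 1$, there are only finitely many $k$-vertex-critical $(2P_2,chair)$-free graphs.
   Context: Graphs are finite and simple, and "finitely many" means up to isomorphism. A graph $G$ is $k$-vertex-critical if $\chi(G)=k$ and $\chi(G-v)<k$ for all $v\in V(G)$, where $\chi$ denotes the chromatic number. A graph is $(H_1,H_2)$-free if it contains no induced subgraph isomorphic to $H_1$ or $H_2$. $2P_2$ is the disjoint union of two edges. The $chair$ is the 5-vertex tree with vertices $a,b,c,d,e$ and edges $ab, bc, cd, ce$ (i.e. a claw $K_{1,3}$ with one edge subdivided once). -}

module Defs where

open import Data.Bool using (Bool; false; T; _∧_; _∨_; not)
open import Data.Bool.Properties using (∨-comm)
open import Data.Fin using (Fin; punchIn)
open import Data.Fin.Patterns using (0F; 1F; 2F; 3F; 4F)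
open import Data.Fin.Permutation using (Permutation; _⟨$⟩ʳ_)
open import Data.Fin.Properties using (_≟_; punchIn-injective)
open import Data.List using (List; []; _∷_)
open import Data.List.Relation.Unary.Any using (Any)
open import Data.Nat using (ℕ; suc; pred; _≤_; _<_)
open import Data.Product using (∃; _×_; _,_; proj₂)
open import Data.Product.Properties using (≡-dec)
open import Function using (_↣_; mk↣; Injection)
open import Relation.Binary.PropositionalEquality using (_≡_; _≢_; refl; cong; cong₂; sym)
open import Relation.Nullary using (¬_; yes; no; does; contradiction)

-- Finite simple graphs on the vertex set Fin n.
record Graph (n : ℕ) : Set where
  field
    adj    : Fin n → Fin n → Bool
    symm   : ∀ u v → adj u v ≡ adj v u
    irrefl : ∀ v → adj v v ≡ false

  Adj : Fin n → Fin n → Set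
  Adj u v = T (adj u v)

open Graph public

infix 4 _≅_

_≅_ : ∀ {m n} → Graph m → Graph n → Set
_≅_ {m} {n} G H =
  ∃ λ (π : Permutation m n) → ∀ u v → adj G u v ≡ adj H (π ⟨$⟩ʳ u) (π ⟨$⟩ʳ v)

-- The subgraph induced by the image of f, with vertices renamed along f.
induced : ∀ {m n} → Graph n → Fin m ↣ Fin n → Graph m
induced G f = record
  { adj    = λ u v → adj G (to u) (to v)
  ; symm   = λ u v → symm G (to u) (to v)
  ; irrefl = λ v → irrefl G (to v)
  } where open Injection f using (to)

infixl 6 _-_

_-_ : ∀ {n} → Graph n → Fin n → Graph (pred n)
_-_ {suc n} G v = induced G (mk↣ {to = punchIn v} (punchIn-injective v _ _))

ContainsInduced : ∀ {n h} → Graph n → Graph h → Set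
ContainsInduced {n} G H = ∃ λ m → ∃ λ (f : Fin m ↣ Fin n) → induced G f ≅ H

_,_-Free : ∀ {h₁ h₂ n} → Graph h₁ → Graph h₂ → Graph n → Set
(H₁ , H₂ -Free) G = ¬ ContainsInduced G H₁ × ¬ ContainsInduced G H₂

Colourable : ∀ {n} → Graph n → ℕ → Set
Colourable {n} G k = ∃ λ (c : Fin n → Fin k) → ∀ u v → Adj G u v → c u ≢ c v

-- χ as a functional relation: χ G k means χ(G) = k.
χ : ∀ {n} → Graph n → ℕ → Set
χ G k = Colourable G k × (∀ j → Colourable G j → k ≤ j)

VertexCritical : ℕ → ∀ {n} → Graph n → Set
VertexCritical k G = χ G k × (∀ v → ∃ λ j → χ (G - v) j × j < k)

-- Finiteness up to isomorphism.  The list may contain graphs outside P and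
-- repetitions: a class covered by finitely many isomorphism types is finite.
FinitelyMany : (∀ {n} → Graph n → Set) → Set
FinitelyMany P =
  ∃ λ (Gs : List (∃ Graph)) → ∀ {n} (G : Graph n) → P G → Any (λ H → G ≅ proj₂ H) Gs

-- Pairs are read as unordered edges; loops are discarded.
fromEdges : ∀ {n} → List (Fin n × Fin n) → Graph n
fromEdges {n} es = record { adj = a ; symm = a-sym ; irrefl = a-irrefl }
  where
  open import Data.List.Membership.DecPropositional (≡-dec (_≟_ {n}) _≟_) using (_∈?_)

  _==_ : Fin n → Fin n → Bool
  u == v = does (u ≟ v)

  a : Fin n → Fin n → Bool
  a u v = not (u == v) ∧ (does ((u , v) ∈? es) ∨ does ((v , u) ∈? es))

  ==-sym : ∀ u v → u == v ≡ v == u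
  ==-sym u v with u ≟ v | v ≟ u
  ... | yes _ | yes _ = refl
  ... | no  _ | no  _ = refl
  ... | yes p | no ¬q = contradiction (sym p) ¬q
  ... | no ¬p | yes q = contradiction (sym q) ¬p

  a-sym : ∀ u v → a u v ≡ a v u
  a-sym u v = cong₂ _∧_ (cong not (==-sym u v)) (∨-comm (does ((u , v) ∈? es)) _)

  a-irrefl : ∀ v → a v v ≡ false
  a-irrefl v with v ≟ v
  ... | yes _ = refl
  ... | no ¬p = contradiction refl ¬p

2P₂ : Graph 4
2P₂ = fromEdges ((0F , 1F) ∷ (2F , 3F) ∷ [])

-- With a, b, c, d, e = 0F, …, 4F the edges are ab, bc, cd, ce.
chair : Graph 5
chair = fromEdges ((0F , 1F) ∷ (1F , 2F) ∷ (2F , 3F) ∷ (2F , 4F) ∷ [])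

{-# OPTIONS --safe #-}
-- Let G be k-vertex-critical and (2P₂, chair)-free, with a k-colouring c.  By criticality,
-- distinct nonadjacent vertices have incomparable neighbourhoods.  Fix a vertex u of a colour
-- class S and choose, for every other w in S, a neighbour y w of u not adjacent to w and a
-- neighbour z w of w not adjacent to u.  2P₂-freeness makes two vertices adjacent as soon as
-- their traces on S are incomparable, and chair-freeness then makes the traces differ by
-- exchanging one vertex only.  It follows that for w ≠ w′ either y w, y w′ or z w, z w′ are
-- adjacent, so w is determined by c (y w) and c (z w).  Hence |S| ≤ 1 + k², and G has at most
-- k (1 + k²) vertices.
module Submission where

open import Data.Bool using (Bool; true; false; T; _∨_)
import Data.Bool.Properties as Bool
open import Data.Fin using (Fin; zero; suc; toℕ; fromℕ<; Fin′; inject; combine; punchOut)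
open import Data.Fin.Patterns using (0F; 1F; 2F; 3F; 4F)
open import Data.Fin.Permutation using () renaming (id to idₚ)
open import Data.Fin.Properties using
  ( _≟_; any?; <-cmp; toℕ-injective; toℕ-fromℕ<; toℕ-inject; punchIn-punchOut
  ; suc-injective; combine-injective; injective⇒≤)
open import Data.List using (List; []; _∷_; _++_; map; concatMap; filter; upTo; allFin; cartesianProduct)
open import Data.List.Membership.Propositional using (_∈_; lose)
open import Data.List.Membership.Propositional.Properties using
  ( ∈-map⁺; ∈-++⁺ˡ; ∈-++⁺ʳ; ∈-filter⁺; ∈-filter⁻; ∈-concatMap⁺; ∈-upTo⁺; ∈-allFin
  ; ∈-cartesianProduct⁺)
open import Data.List.Relation.Unary.Any using (here)
open import Data.Nat using (ℕ; suc; _+_; _*_; _≤_; _<_; _≥_; s≤s)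
import Data.Nat.Properties as ℕ
open import Data.Product using (∃; _×_; _,_; proj₁; proj₂)
open import Data.Product.Properties using (≡-dec)
open import Data.Vec using (lookup; []; _∷_)
open import Function using (mk↣; Equivalence)
open import Relation.Binary.Definitions using (tri<; tri≈; tri>)
open import Relation.Binary.PropositionalEquality using
  (_≡_; _≢_; refl; sym; trans; cong₂; subst; ≢-sym)
open import Relation.Nullary using (¬_; Dec; yes; no; does; contradiction; _×-dec_)
open import Relation.Nullary.Decidable using (dec-true; dec-false)
open import Relation.Unary using (Pred; Decidable)
open import Defs

module _ {a} {A : Set a} where

  sublists : List A → List (List A)
  sublists []       = [] ∷ []
  sublists (x ∷ xs) = map (x ∷_) (sublists xs) ++ sublists xs

  filter∈sublists : ∀ {p} {P : Pred A p} (P? : Decidable P) xs → filter P? xs ∈ sublists xs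
  filter∈sublists P? [] = here refl
  filter∈sublists P? (x ∷ xs) with P? x
  ... | yes _ = ∈-++⁺ˡ (∈-map⁺ (x ∷_) (filter∈sublists P? xs))
  ... | no  _ = ∈-++⁺ʳ _ (filter∈sublists P? xs)

allPairs : ∀ n → List (Fin n × Fin n)
allPairs n = cartesianProduct (allFin n) (allFin n)

edges : ∀ {n} → Graph n → List (Fin n × Fin n)
edges {n} G = filter (λ (u , v) → adj G u v Bool.≟ true) (allPairs n)

≅-fromEdges : ∀ {n} (G : Graph n) → G ≅ fromEdges (edges G)
≅-fromEdges {n} G = idₚ , adj≡
  where
  open import Data.List.Membership.DecPropositional (≡-dec (_≟_ {n}) _≟_) using (_∈?_)

  E? : ∀ e → Dec (adj G (proj₁ e) (proj₂ e) ≡ true)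
  E? (u , v) = adj G u v Bool.≟ true

  ∈?-edges : ∀ u v → does ((u , v) ∈? edges G) ≡ adj G u v
  ∈?-edges u v with adj G u v in uv
  ... | true  = dec-true (_ ∈? _)
                  (∈-filter⁺ E? (∈-cartesianProduct⁺ (∈-allFin u) (∈-allFin v)) uv)
  ... | false = dec-false (_ ∈? _)
                  λ e → Bool.not-¬ uv (proj₂ (∈-filter⁻ E? {xs = allPairs n} e))

  adj≡ : ∀ u v → adj G u v ≡ adj (fromEdges (edges G)) u v
  adj≡ u v with u ≟ v
  ... | yes refl = irrefl G u
  -- `edges G` lists each edge in both orientations, so both membership tests equal `adj G u v` and
  -- their disjunction collapses.
  ... | no  _    = sym (trans (cong₂ _∨_ (∈?-edges u v) (trans (∈?-edges v u) (symm G v u)))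
                              (Bool.∨-idem (adj G u v)))

-- A graph is recovered up to isomorphism from its edge list, a sublist of `allPairs n`, so each
-- order up to `N` contributes finitely many candidates.
bounded⇒finitelyMany : ∀ (P : ∀ {n} → Graph n → Set) N →
                       (∀ {n} (G : Graph n) → P G → n ≤ N) → FinitelyMany P
bounded⇒finitelyMany P N bound = concatMap graphs (upTo (suc N)) , λ {n} G p →
  lose (∈-concatMap⁺ graphs (lose (∈-upTo⁺ (s≤s (bound G p)))
         (∈-map⁺ _ (filter∈sublists (λ (u , v) → adj G u v Bool.≟ true) (allPairs n)))))
       (≅-fromEdges G)
  where
  graphs : ℕ → List (∃ Graph)
  graphs n = map (λ es → n , fromEdges es) (sublists (allPairs n))

fromℕ<-inject : ∀ {n} {i j : Fin n} (i<j : toℕ i < toℕ j) → inject (fromℕ< i<j) ≡ i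
fromℕ<-inject i<j = toℕ-injective (trans (toℕ-inject (fromℕ< i<j)) (toℕ-fromℕ< i<j))

module _ {n} (G : Graph n) where

  private
    flip : ∀ {u v b} → adj G u v ≡ b → adj G v u ≡ b
    flip {u} {v} = trans (symm G v u)

  -- By symmetry the pairs `i < j` suffice, and `Fin′ j` turns them into a finite pattern match for
  -- a concrete `H`. Distinctness is asked for because nonadjacent vertices could share an image.
  embed : ∀ {h} (H : Graph h) (f : Fin h → Fin n) →
          (∀ j (i : Fin′ j) → f (inject i) ≢ f j
                            × adj G (f (inject i)) (f j) ≡ adj H (inject i) j) →
          ContainsInduced G H
  embed {h} H f pairs = h , mk↣ f-injective , idₚ , f-adj
    where
    pair : ∀ {i j} → toℕ i < toℕ j → f i ≢ f j × adj G (f i) (f j) ≡ adj H i j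
    pair {i} {j} i<j = subst (λ i → f i ≢ f j × adj G (f i) (f j) ≡ adj H i j)
                             (fromℕ<-inject i<j) (pairs j (fromℕ< i<j))

    f-injective : ∀ {i j} → f i ≡ f j → i ≡ j
    f-injective {i} {j} eq with <-cmp i j
    ... | tri< i<j _ _ = contradiction eq (proj₁ (pair i<j))
    ... | tri≈ _ i≡j _ = i≡j
    ... | tri> _ _ j<i = contradiction (sym eq) (proj₁ (pair j<i))

    f-adj : ∀ i j → adj G (f i) (f j) ≡ adj H i j
    f-adj i j with <-cmp i j
    ... | tri< i<j _ _  = proj₂ (pair i<j)
    ... | tri≈ _ refl _ = trans (irrefl G _) (sym (irrefl H i))
    ... | tri> _ _ j<i  = trans (flip (proj₂ (pair j<i))) (symm H j i)

  separated : ∀ {u v x} → adj G u x ≡ true → adj G v x ≡ false → u ≢ v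
  separated ux vx refl = Bool.not-¬ vx ux

  -- Otherwise the edges `ux` and `vy` would induce `2P₂`.
  private-neighbours-adjacent : ¬ ContainsInduced G 2P₂ → ∀ {u v x y} → adj G u v ≡ false →
    adj G u x ≡ true → adj G v x ≡ false → adj G v y ≡ true → adj G u y ≡ false →
    adj G x y ≡ true
  private-neighbours-adjacent 2P₂-free {u} {v} {x} {y} uv ux vx vy uy with adj G x y in xy
  ... | true  = refl
  ... | false = contradiction (embed 2P₂ (lookup (u ∷ x ∷ v ∷ y ∷ [])) pairs) 2P₂-free
    where
    f = lookup (u ∷ x ∷ v ∷ y ∷ [])
    pairs : ∀ j (i : Fin′ j) → f (inject i) ≢ f j
                             × adj G (f (inject i)) (f j) ≡ adj 2P₂ (inject i) j
    pairs 1F 0F = separated ux (irrefl G x) , ux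
    pairs 2F 0F = separated ux vx , uv
    pairs 2F 1F = separated (flip ux) (flip uv) , flip vx
    pairs 3F 0F = separated ux (flip xy) , uy
    pairs 3F 1F = separated (flip ux) (flip uy) , xy
    pairs 3F 2F = separated vy (irrefl G y) , vy

  -- The adjacencies tell any two of the five vertices apart except the twin leaves `d` and `e`, so
  -- only their distinctness is assumed.
  no-chair : ¬ ContainsInduced G chair → ∀ {a b c d e} →
    adj G a b ≡ true → adj G b c ≡ true → adj G c d ≡ true → adj G c e ≡ true →
    adj G a c ≡ false → adj G a d ≡ false → adj G a e ≡ false →
    adj G b d ≡ false → adj G b e ≡ false → adj G d e ≡ false → ¬ d ≢ e
  no-chair chair-free {a} {b} {c} {d} {e} ab bc cd ce ac ad ae bd be de d≢e =
    chair-free (embed chair f pairs)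
    where
    f = lookup (a ∷ b ∷ c ∷ d ∷ e ∷ [])
    pairs : ∀ j (i : Fin′ j) → f (inject i) ≢ f j
                             × adj G (f (inject i)) (f j) ≡ adj chair (inject i) j
    pairs 1F 0F = separated ab (irrefl G b) , ab
    pairs 2F 0F = ≢-sym (separated cd ad) , ac
    pairs 2F 1F = separated bc (irrefl G c) , bc
    pairs 3F 0F = separated ab (flip bd) , ad
    pairs 3F 1F = separated (flip ab) (flip ad) , bd
    pairs 3F 2F = separated cd (irrefl G d) , cd
    pairs 4F 0F = separated ab (flip be) , ae
    pairs 4F 1F = separated (flip ab) (flip ae) , be
    pairs 4F 2F = separated ce (irrefl G e) , ce
    pairs 4F 3F = d≢e , de

  module _ (free : (2P₂ , chair -Free) G) where

    -- Here `u x y v` is an induced path. If `w` saw exactly one of `x` and `y`, it would be a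
    -- second leaf there and complete a chair.
    private-neighbours-agree : ∀ {u v x y w} → adj G u v ≡ false →
      adj G u x ≡ true → adj G v x ≡ false → adj G v y ≡ true → adj G u y ≡ false →
      u ≢ w → v ≢ w → adj G u w ≡ false → adj G v w ≡ false → adj G x w ≡ adj G y w
    private-neighbours-agree {u} {v} {x} {y} {w} uv ux vx vy uy u≢w v≢w uw vw
      with adj G x w in xw | adj G y w in yw
    ... | true  | true  = refl
    ... | false | false = refl
    ... | true  | false = contradiction u≢w
      (no-chair (proj₂ free) vy (flip xy) (flip ux) xw vx (flip uv) vw (flip uy) yw uw)
      where xy = private-neighbours-adjacent (proj₁ free) uv ux vx vy uy
    ... | false | true  = contradiction v≢w
      (no-chair (proj₂ free) ux xy (flip vy) yw uy uv uw (flip vx) xw vw)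
      where xy = private-neighbours-adjacent (proj₁ free) uv ux vx vy uy

    private-neighbours-injective : ∀ {u w w′ y y′ z z′} →
      u ≢ w → u ≢ w′ → w ≢ w′ → adj G u w ≡ false → adj G u w′ ≡ false → adj G w w′ ≡ false →
      adj G u y  ≡ true → adj G w  y  ≡ false → adj G w  z  ≡ true → adj G u z  ≡ false →
      adj G u y′ ≡ true → adj G w′ y′ ≡ false → adj G w′ z′ ≡ true → adj G u z′ ≡ false →
      adj G y y′ ≡ false → adj G z z′ ≢ false
    private-neighbours-injective {u} {w} {w′} {y} {y′} {z} {z′}
      u≢w u≢w′ w≢w′ uw uw′ ww′ uy wy wz uz uy′ w′y′ w′z′ uz′ yy′ zz′
      with adj G y w′ in yw′ | adj G y′ w in y′w
         -- These two equations say that `z` treats `w′` as `y` does, and `z′` treats `w` as `y′`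
         -- does.
         | private-neighbours-agree uw uy wy wz uz u≢w′ w≢w′ uw′ ww′
         | private-neighbours-agree uw′ uy′ w′y′ w′z′ uz′ u≢w (≢-sym w≢w′) uw (flip ww′)
    -- When the two answers agree, `y, y′` or `z, z′` are private neighbours of `w` and `w′` against
    -- each other, hence adjacent.
    ... | true  | true  | _     | _     = Bool.not-¬ yy′
      (flip (private-neighbours-adjacent (proj₁ free) ww′ (flip y′w) w′y′ (flip yw′) wy))
    ... | false | false | yw′≡z | y′w≡z = Bool.not-¬ zz′
      (private-neighbours-adjacent (proj₁ free) ww′ wz (flip (sym yw′≡z)) w′z′ (flip (sym y′w≡z)))
    -- Now `z` sees `w′` and can replace `z′`, so `y′` and `z` must agree on `w`; but `w` sees only
    -- `z`. The last case is the mirror image, with `z′` replacing `z`.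
    ... | true  | false | yw′≡z | _     = Bool.not-¬ y′w (trans
      (private-neighbours-agree uw′ uy′ w′y′ (flip (sym yw′≡z)) uz u≢w (≢-sym w≢w′) uw (flip ww′))
      (flip wz))
    ... | false | true  | _     | y′w≡z = Bool.not-¬ yw′ (trans
      (private-neighbours-agree uw uy wy (flip (sym y′w≡z)) uz′ u≢w′ w≢w′ uw′ ww′)
      (flip w′z′))

  -- Used for both orders of a pair, this is incomparability of neighbourhoods; the two witnesses
  -- are the private neighbours.
  Separating : Set
  Separating = ∀ {u v} → u ≢ v → adj G u v ≡ false →
               ∃ λ x → adj G u x ≡ true × adj G v x ≡ false

  module _ (free : (2P₂ , chair -Free) G) (separate : Separating) {k} (colouring : Colourable G k) where

    private
      c = proj₁ colouring

      same-colour : ∀ {u v} → c u ≡ c v → adj G u v ≡ false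
      same-colour {u} {v} eq = Bool.¬-not
        λ uv → proj₂ colouring u v (Equivalence.from Bool.T-≡ uv) eq

      -- `zero` is reserved for the representative `u`, and the successors hold the `k * k` colour
      -- pairs. Taking the decision as an argument gives the whole class one representative.
      code : ∀ {i} → Dec (∃ λ u → c u ≡ i) → ∀ v → c v ≡ i → Fin (1 + k * k)
      code (no none) v p = contradiction (v , p) none
      code (yes (u , q)) v p with u ≟ v
      ... | yes _   = zero
      ... | no  u≢v = suc (combine (c (proj₁ (separate u≢v (same-colour (trans q (sym p))))))
                                   (c (proj₁ (separate (≢-sym u≢v) (same-colour (trans p (sym q)))))))

      code-injective : ∀ {i} (d : Dec (∃ λ u → c u ≡ i)) {v v′} (p : c v ≡ i) (p′ : c v′ ≡ i) →
                       code d v p ≡ code d v′ p′ → v ≡ v′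
      code-injective (no none) p p′ _ = contradiction (_ , p) none
      code-injective (yes (u , q)) {v} {v′} p p′ eq with u ≟ v | u ≟ v′
      -- The mixed cases would equate `zero` with a successor.
      ... | yes u≡v | yes u≡v′ = trans (sym u≡v) u≡v′
      ... | no  u≢v | no  u≢v′ with v ≟ v′
      ...   | yes v≡v′ = v≡v′
      ...   | no  v≢v′
        with y  , uy  , vy   ← separate u≢v (same-colour (trans q (sym p)))
           | z  , vz  , uz   ← separate (≢-sym u≢v) (same-colour (trans p (sym q)))
           | y′ , uy′ , v′y′ ← separate u≢v′ (same-colour (trans q (sym p′)))
           | z′ , v′z′ , uz′ ← separate (≢-sym u≢v′) (same-colour (trans p′ (sym q)))
        with cy , cz ← combine-injective (c y) (c z) (c y′) (c z′) (suc-injective eq) =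
        contradiction (same-colour cz)
          (private-neighbours-injective free u≢v u≢v′ v≢v′
            (same-colour (trans q (sym p))) (same-colour (trans q (sym p′)))
            (same-colour (trans p (sym p′)))
            uy vy vz uz uy′ v′y′ v′z′ uz′ (same-colour cy))

      class? : ∀ i → Dec (∃ λ u → c u ≡ i)
      class? i = any? λ u → c u ≟ i

      -- In `c v ≡ c v′` neither side is a variable to match on; naming the colours `i` and `j` lets
      -- the two decisions, and so the representatives, be identified.
      code-class-injective : ∀ {i j} → i ≡ j → ∀ {v v′} (p : c v ≡ i) (p′ : c v′ ≡ j) →
                             code (class? i) v p ≡ code (class? j) v′ p′ → v ≡ v′
      code-class-injective {i} refl = code-injective (class? i)

    order-bound : n ≤ k * (1 + k * k)
    order-bound = injective⇒≤ {f = λ v → combine (c v) (code (class? (c v)) v refl)}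
      λ {v} {v′} eq → let cv≡cv′ , codes≡ = combine-injective (c v) _ (c v′) _ eq
                      in code-class-injective cv≡cv′ refl refl codes≡

-- Since `φ` misses `v`, it is a homomorphism from `G` to `G - v`, and colourings pull back along
-- it.
colour-via-fold : ∀ {m j} (G : Graph (suc m)) v (φ : Fin (suc m) → Fin (suc m)) →
                  (∀ x → v ≢ φ x) → (∀ x y → Adj G x y → Adj G (φ x) (φ y)) →
                  Colourable (G - v) j → Colourable G j
colour-via-fold G v φ v≢φ φ-hom (c , proper) =
  (λ x → c (punchOut (v≢φ x))) , λ x y xy → proper _ _
    (subst T (sym (cong₂ (adj G) (punchIn-punchOut (v≢φ x)) (punchIn-punchOut (v≢φ y)))) (φ-hom x y xy))

-- Without a separator every neighbour of `u` is one of `v`, so folding `u` onto `v` carries a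
-- colouring of `G - u` with fewer than `k` colours back to `G`.
critical⇒separating : ∀ {n k} (G : Graph n) → VertexCritical k G → Separating G
critical⇒separating {suc n} G (χG , critical) {u} {v} u≢v uv
  with any? (λ x → (adj G u x Bool.≟ true) ×-dec (adj G v x Bool.≟ false))
... | yes separator = separator
... | no none with critical u
...   | j , (G-u-colourable , _) , j<k =
  contradiction (proj₂ χG j (colour-via-fold G u φ u≢φ φ-hom G-u-colourable)) (ℕ.<⇒≱ j<k)
  where
  φ : Fin (suc n) → Fin (suc n)
  φ x with u ≟ x
  ... | yes _ = v
  ... | no  _ = x

  u≢φ : ∀ x → u ≢ φ x
  u≢φ x with u ≟ x
  ... | yes _   = u≢v
  ... | no  u≢x = u≢x

  Nu⊆Nv : ∀ {x} → Adj G u x → Adj G v x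
  Nu⊆Nv ux = Equivalence.from Bool.T-≡ (Bool.¬-not λ vx → none (_ , Equivalence.to Bool.T-≡ ux , vx))

  φ-hom : ∀ x y → Adj G x y → Adj G (φ x) (φ y)
  φ-hom x y xy with u ≟ x | u ≟ y
  ... | yes refl | yes refl = contradiction (subst T (irrefl G u) xy) λ ()
  ... | yes refl | no _     = Nu⊆Nv xy
  ... | no _     | yes refl = subst T (symm G v x) (Nu⊆Nv (subst T (symm G x u) xy))
  ... | no _     | no _     = xy

corollary4p3 : (k : ℕ) → k ≥ 1 → FinitelyMany (λ G → VertexCritical k G × (2P₂ , chair -Free) G)
corollary4p3 k _ = bounded⇒finitelyMany _ (k * (1 + k * k)) λ G (critical@((colouring , _) , _) , free) →
  order-bound G free (critical⇒separating G critical) colouring
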